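{- Every idempotent Boolean magma $(A,\wedge,\vee,\neg,\bot,\top,\cdot)$ is unary-determined, i.e., satisfies $x\cdot y=((x\cdot\top)\wedge y)\vee(x\wedge(\top\cdot y))$ for all $x,y\in A$.
   Context: A Boolean magma is a Boolean algebra $(A,\wedge,\vee,\neg,\bot,\top)$ with a binary operation $\cdot$ that distributes over binary joins in each argument: $x\cdot(y\vee z)=x\cdot y\vee x\cdot z$ and $(x\vee y)\cdot z=x\cdot z\vee y\cdot z$. It is idempotent if $x\cdot x=x$ for all $x\in A$. -}

module Defs where

open import Algebra.Core using (Op₂)
open import Algebra.Definitions using (Congruent₂; _DistributesOver_; Idempotent)
open import Algebra.Lattice.Bundles using (BooleanAlgebra)
open import Level using (suc; _⊔_)

-- Only binary joins are preserved: x · ⊥ ≈ ⊥ and ⊥ · x ≈ ⊥ are not assumed.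
-- The field ·-cong is there because the equality of a BooleanAlgebra is a setoid
-- equality.
record BooleanMagma c ℓ : Set (suc (c ⊔ ℓ)) where
  infixl 7 _·_
  field
    booleanAlgebra : BooleanAlgebra c ℓ

  open BooleanAlgebra booleanAlgebra public

  field
    _·_          : Op₂ Carrier
    ·-cong       : Congruent₂ _≈_ _·_
    ·-distrib-∨  : _DistributesOver_ _≈_ _·_ _∨_

IsIdempotent : ∀ {c ℓ} → BooleanMagma c ℓ → Set (c ⊔ ℓ)
IsIdempotent A = Idempotent _≈_ _·_
  where open BooleanMagma A

IsUnaryDetermined : ∀ {c ℓ} → BooleanMagma c ℓ → Set (c ⊔ ℓ)
IsUnaryDetermined A = ∀ x y → x · y ≈ ((x · ⊤) ∧ y) ∨ (x ∧ (⊤ · y))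
  where open BooleanMagma A

{-# OPTIONS --safe #-}

-- Monotonicity and idempotence give x ∧ y ≤ x · y ≤ x ∨ y. The upper bound
-- splits x · y into its parts below x and below y, which gives one inequality.
-- For the other, split x · ⊤ as x · y ∨ x · ¬ y: the second part is at most
-- x ∨ ¬ y, so its meet with y is at most x ∧ y ≤ x · y; dually for ⊤ · y.
module Submission where

open import Defs
open import Algebra.Lattice.Bundles using (BooleanAlgebra)
open import Data.Product.Base using (proj₁; proj₂)
open import Level using (Level)
open import Relation.Binary.Definitions using (Monotonic₂)
import Algebra.Lattice.Properties.BooleanAlgebra as BooleanAlgebraProperties
import Relation.Binary.Lattice.Bundles as Order
import Relation.Binary.Lattice.Properties.JoinSemilattice as JoinSemilatticeProperties
import Relation.Binary.Lattice.Properties.MeetSemilattice as MeetSemilatticeProperties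
import Relation.Binary.Reasoning.PartialOrder as ≤-Reasoning

module BooleanAlgebraOrder {c ℓ} (B : BooleanAlgebra c ℓ) where

  open BooleanAlgebra B
  open BooleanAlgebraProperties B public
    using (∨-identityˡ; ∨-∧-orderTheoreticLattice; poset)
  open Order.Lattice ∨-∧-orderTheoreticLattice public
    using
    ( _≤_; antisym; x≤x∨y; y≤x∨y; ∨-least; x∧y≤x; x∧y≤y; ∧-greatest
    ; joinSemilattice; meetSemilattice
    )
    renaming (refl to ≤-refl; trans to ≤-trans)
  open JoinSemilatticeProperties joinSemilattice public
    using (∨-monotonic; x≤y⇒x∨y≈y)
  open MeetSemilatticeProperties meetSemilattice public
    using (∧-monotonic)
  open ≤-Reasoning poset

  x≤⊤ : ∀ x → x ≤ ⊤
  x≤⊤ x = begin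
    x        ≤⟨ x≤x∨y x (¬ x) ⟩
    x ∨ ¬ x  ≈⟨ ∨-complementʳ x ⟩
    ⊤        ∎

  -- Modus ponens: `¬ x ∨ y` is the Boolean implication from `x` to `y`.
  x∧[¬x∨y]≤y : ∀ x y → x ∧ (¬ x ∨ y) ≤ y
  x∧[¬x∨y]≤y x y = begin
    x ∧ (¬ x ∨ y)        ≈⟨ ∧-distribˡ-∨ x (¬ x) y ⟩
    (x ∧ ¬ x) ∨ (x ∧ y)  ≈⟨ ∨-congʳ (∧-complementʳ x) ⟩
    ⊥ ∨ (x ∧ y)          ≈⟨ ∨-identityˡ (x ∧ y) ⟩
    x ∧ y                ≤⟨ x∧y≤y x y ⟩
    y                    ∎

module IdempotentBooleanMagma {c ℓ} (A : BooleanMagma c ℓ) (idem : IsIdempotent A) where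

  open BooleanMagma A
  open BooleanAlgebraOrder booleanAlgebra
  open ≤-Reasoning poset

  -- If `y ≤ z` then `z` is `y ∨ z`, so distributivity exhibits `x · z` as a join with `x · y` as
  -- one part.
  ·-monoʳ : ∀ x {y z} → y ≤ z → x · y ≤ x · z
  ·-monoʳ x {y} {z} y≤z = begin
    x · y          ≤⟨ x≤x∨y (x · y) (x · z) ⟩
    x · y ∨ x · z  ≈⟨ proj₁ ·-distrib-∨ x y z ⟨
    x · (y ∨ z)    ≈⟨ ·-cong refl (x≤y⇒x∨y≈y y≤z) ⟩
    x · z          ∎

  ·-monoˡ : ∀ z {x y} → x ≤ y → x · z ≤ y · z
  ·-monoˡ z {x} {y} x≤y = begin
    x · z          ≤⟨ x≤x∨y (x · z) (y · z) ⟩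
    x · z ∨ y · z  ≈⟨ proj₂ ·-distrib-∨ z x y ⟨
    (x ∨ y) · z    ≈⟨ ·-cong (x≤y⇒x∨y≈y x≤y) refl ⟩
    y · z          ∎

  ·-mono : Monotonic₂ _≤_ _≤_ _≤_ _·_
  ·-mono {x} {y} {u} {v} x≤y u≤v = ≤-trans (·-monoˡ u x≤y) (·-monoʳ y u≤v)

  -- Idempotence turns the meet into its own square, whose two factors are then enlarged
  -- independently.
  x∧y≤x·y : ∀ x y → x ∧ y ≤ x · y
  x∧y≤x·y x y = begin
    x ∧ y              ≈⟨ idem (x ∧ y) ⟨
    (x ∧ y) · (x ∧ y)  ≤⟨ ·-mono (x∧y≤x x y) (x∧y≤y x y) ⟩
    x · y              ∎

  x·y≤x∨y : ∀ x y → x · y ≤ x ∨ y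
  x·y≤x∨y x y = begin
    x · y              ≤⟨ ·-mono (x≤x∨y x y) (y≤x∨y x y) ⟩
    (x ∨ y) · (x ∨ y)  ≈⟨ idem (x ∨ y) ⟩
    x ∨ y              ∎

  -- Since `¬ x · y` lies below the implication `¬ x ∨ y`, its part inside `x` lies below `y` too,
  -- hence below `x ∧ y`.
  x∧[¬x·y]≤x·y : ∀ x y → x ∧ (¬ x · y) ≤ x · y
  x∧[¬x·y]≤x·y x y = begin
    x ∧ (¬ x · y)  ≤⟨ ∧-greatest (x∧y≤x x _) (begin
      x ∧ (¬ x · y)  ≤⟨ ∧-monotonic ≤-refl (x·y≤x∨y (¬ x) y) ⟩
      x ∧ (¬ x ∨ y)  ≤⟨ x∧[¬x∨y]≤y x y ⟩
      y              ∎) ⟩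
    x ∧ y          ≤⟨ x∧y≤x·y x y ⟩
    x · y          ∎

  -- The mirror image: `x · ¬ y` lies below the implication from `y` to `x`, up to commutativity.
  [x·¬y]∧y≤x·y : ∀ x y → (x · ¬ y) ∧ y ≤ x · y
  [x·¬y]∧y≤x·y x y = begin
    (x · ¬ y) ∧ y  ≤⟨ ∧-greatest (begin
      (x · ¬ y) ∧ y  ≤⟨ ∧-monotonic (x·y≤x∨y x (¬ y)) ≤-refl ⟩
      (x ∨ ¬ y) ∧ y  ≈⟨ ∧-comm (x ∨ ¬ y) y ⟩
      y ∧ (x ∨ ¬ y)  ≈⟨ ∧-congˡ (∨-comm x (¬ y)) ⟩
      y ∧ (¬ y ∨ x)  ≤⟨ x∧[¬x∨y]≤y y x ⟩
      x              ∎) (x∧y≤y _ y) ⟩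
    x ∧ y          ≤⟨ x∧y≤x·y x y ⟩
    x · y          ∎

  x∧[⊤·y]≤x·y : ∀ x y → x ∧ (⊤ · y) ≤ x · y
  x∧[⊤·y]≤x·y x y = begin
    -- Split `⊤` along the element that the product is met with, so that the `¬ x` part meets its
    -- own complement.
    x ∧ (⊤ · y)                      ≈⟨ ∧-congˡ (·-cong (∨-complementʳ x) refl) ⟨
    x ∧ ((x ∨ ¬ x) · y)              ≈⟨ ∧-congˡ (proj₂ ·-distrib-∨ y x (¬ x)) ⟩
    x ∧ (x · y ∨ ¬ x · y)            ≈⟨ ∧-distribˡ-∨ x (x · y) (¬ x · y) ⟩
    (x ∧ (x · y)) ∨ (x ∧ (¬ x · y))  ≤⟨ ∨-least (x∧y≤y x (x · y)) (x∧[¬x·y]≤x·y x y) ⟩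
    x · y                            ∎

  [x·⊤]∧y≤x·y : ∀ x y → (x · ⊤) ∧ y ≤ x · y
  [x·⊤]∧y≤x·y x y = begin
    -- Here the meet is with `y`, so `⊤` is split along `y`.
    (x · ⊤) ∧ y                      ≈⟨ ∧-congʳ (·-cong refl (∨-complementʳ y)) ⟨
    (x · (y ∨ ¬ y)) ∧ y              ≈⟨ ∧-congʳ (proj₁ ·-distrib-∨ x y (¬ y)) ⟩
    (x · y ∨ x · ¬ y) ∧ y            ≈⟨ ∧-distribʳ-∨ y (x · y) (x · ¬ y) ⟩
    ((x · y) ∧ y) ∨ ((x · ¬ y) ∧ y)  ≤⟨ ∨-least (x∧y≤x (x · y) y) ([x·¬y]∧y≤x·y x y) ⟩
    x · y                            ∎

  x·y≤[x·⊤∧y]∨[x∧⊤·y] : ∀ x y → x · y ≤ ((x · ⊤) ∧ y) ∨ (x ∧ (⊤ · y))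
  x·y≤[x·⊤∧y]∨[x∧⊤·y] x y = begin
    -- Meeting with an upper bound loses nothing, and distributing over `x ∨ y` cuts the product in
    -- two.
    x · y                          ≤⟨ ∧-greatest ≤-refl (x·y≤x∨y x y) ⟩
    (x · y) ∧ (x ∨ y)              ≈⟨ ∧-congˡ (∨-comm x y) ⟩
    (x · y) ∧ (y ∨ x)              ≈⟨ ∧-distribˡ-∨ (x · y) y x ⟩
    ((x · y) ∧ y) ∨ ((x · y) ∧ x)  ≈⟨ ∨-congˡ (∧-comm (x · y) x) ⟩
    -- In each part, the factor that the outer meet keeps is the one enlarged to `⊤`.
    ((x · y) ∧ y) ∨ (x ∧ (x · y))  ≤⟨ ∨-monotonic
                                        (∧-monotonic (·-monoʳ x (x≤⊤ y)) ≤-refl)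
                                        (∧-monotonic ≤-refl (·-monoˡ y (x≤⊤ x))) ⟩
    ((x · ⊤) ∧ y) ∨ (x ∧ (⊤ · y))  ∎

lemma2p3 : ∀ {c ℓ : Level} (A : BooleanMagma c ℓ) → IsIdempotent A → IsUnaryDetermined A
lemma2p3 A idem x y =
  antisym (x·y≤[x·⊤∧y]∨[x∧⊤·y] x y) (∨-least ([x·⊤]∧y≤x·y x y) (x∧[⊤·y]≤x·y x y))
  where
  open BooleanMagma A using (booleanAlgebra)
  open BooleanAlgebraOrder booleanAlgebra
  open IdempotentBooleanMagma A idem
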